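{- Let $T=\{2413,2431,3214\}$. Then $$F_T(x)=\frac{1-5x+7x^2-4x^3}{1-6x+11x^2-9x^3+2x^4}.$$
   Context: $S_n(T)$ denotes the set of permutations $\pi$ of $[n]=\{1,\dots,n\}$ (one-line notation) that avoid every pattern $\tau\in T$, i.e. no subsequence of $\pi$ is order-isomorphic to $\tau$. $F_T(x)=\sum_{n\ge 0}|S_n(T)|x^n$, a formal power series, with $|S_0(T)|=1$. -}

module Defs where

open import Data.Fin using (Fin; cast; toℕ; zero; suc)
open import Data.Fin.Properties using (all?)
open import Data.Integer using (ℤ; +_; 0ℤ; 1ℤ)
import Data.Integer as ℤ
import Data.Integer.Properties as ℤ
import Algebra.Properties.Semiring.Sum ℤ.+-*-semiring as Σℤ
open import Data.Integer.Tactic.RingSolver using (solve-∀)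
open import Data.List using (List; []; _∷_; [_]; _++_; length; lookup; map; upTo; filter; concatMap)
open import Data.List.Membership.Propositional using (_∈_; _∉_; find; lose)
open import Data.List.Membership.Propositional.Properties
  using (∈-map⁺; ∈-map⁻; ∈-concatMap⁺; ∈-concatMap⁻; ∈-∃++; ∈-filter⁺; ∈-filter⁻)
open import Data.List.Properties using (∷-injectiveʳ)
open import Data.List.Relation.Binary.Disjoint.Propositional using (Disjoint)
open import Data.List.Relation.Binary.Permutation.Propositional using (_↭_; ↭-refl; ↭-sym; ↭-trans; prep; swap)
open import Data.List.Relation.Binary.Permutation.Propositional.Properties
  using (↭-empty-inv; ∈-resp-↭; drop-mid)
open import Data.List.Relation.Binary.Sublist.Propositional using (_⊆_; []; _∷ʳ_; _∷_)
open import Data.List.Relation.Unary.All using (All; []; _∷_)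
import Data.List.Relation.Unary.All as All
open import Data.List.Relation.Unary.AllPairs using ([]; _∷_)
open import Data.List.Relation.Unary.Any using (here; there)
open import Data.List.Relation.Unary.Unique.Propositional using (Unique)
import Data.List.Relation.Unary.Unique.Propositional.Properties as Unique
open import Data.Nat using (ℕ; zero; suc; _<_; _∸_; _<?_; _≟_)
open import Data.Nat.Properties using (suc-injective)
open import Data.Product using (Σ-syntax; ∃-syntax; _×_; _,_; proj₁; proj₂)
open import Data.Sum using (inj₁; inj₂)
open import Function using (_∘_; _⇔_; mk⇔; Equivalence)
open import Relation.Binary.PropositionalEquality
  using (_≡_; refl; sym; trans; cong; cong₂; module ≡-Reasoning)
open import Relation.Nullary using (¬_; Dec; yes; no; contradiction)
open import Relation.Nullary.Decidable using (True; toWitness; map′; ¬?; _×-dec_; _→-dec_; _⊎-dec_)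

-- Permutations and patterns are lists of naturals in one-line notation.
OrderIsomorphic : List ℕ → List ℕ → Set
OrderIsomorphic σ τ =
  Σ[ eq ∈ length σ ≡ length τ ]
    (∀ i j → (lookup σ i < lookup σ j) ⇔ (lookup τ (cast eq i) < lookup τ (cast eq j)))

-- _⊆_ is the order-preserving sublist relation: σ is a subsequence of π.
_Contains_ : List ℕ → List ℕ → Set
π Contains τ = ∃[ σ ] (σ ⊆ π × OrderIsomorphic σ τ)

_Avoids_ : List ℕ → List ℕ → Set
π Avoids τ = ¬ (π Contains τ)

[1‥_] : ℕ → List ℕ
[1‥ n ] = map suc (upTo n)

S : ℕ → List (List ℕ) → List ℕ → Set
S n T π = π ↭ [1‥ n ] × All (π Avoids_) T

orderIsomorphic? : ∀ σ τ → Dec (OrderIsomorphic σ τ)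
orderIsomorphic? σ τ with length σ ≟ length τ
... | no  ≢ = no (≢ ∘ proj₁)
... | yes eq = map′ (eq ,_) proj₂ (all? λ i → all? λ j →
  let a<b? = lookup σ i <? lookup σ j
      c<d? = lookup τ (cast eq i) <? lookup τ (cast eq j)
  in map′ (λ (f , g) → mk⇔ f g) (λ e → Equivalence.to e , Equivalence.from e)
          ((a<b? →-dec c<d?) ×-dec (c<d? →-dec a<b?)))

∃⊆? : {P : List ℕ → Set} → (∀ σ → Dec (P σ)) → ∀ π → Dec (∃[ σ ] (σ ⊆ π × P σ))
∃⊆? P? [] = map′ (λ p → [] , [] , p) (λ { (.[] , [] , p) → p }) (P? [])
∃⊆? P? (x ∷ π) = map′
  (λ { (inj₁ (σ , σ⊆π , p)) → σ , x ∷ʳ σ⊆π , p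
     ; (inj₂ (σ , σ⊆π , p)) → x ∷ σ , refl ∷ σ⊆π , p })
  (λ { (σ , .x ∷ʳ σ⊆π , p) → inj₁ (σ , σ⊆π , p)
     ; (.x ∷ σ , refl ∷ σ⊆π , p) → inj₂ (σ , σ⊆π , p) })
  (∃⊆? P? π ⊎-dec ∃⊆? (P? ∘ (x ∷_)) π)

_avoids?_ : ∀ π τ → Dec (π Avoids τ)
π avoids? τ = ¬? (∃⊆? (λ σ → orderIsomorphic? σ τ) π)

insertions : ℕ → List ℕ → List (List ℕ)
insertions x []       = [ [ x ] ]
insertions x (y ∷ ys) = (x ∷ y ∷ ys) ∷ map (y ∷_) (insertions x ys)

permutations : List ℕ → List (List ℕ)
permutations []       = [ [] ]
permutations (x ∷ xs) = concatMap (insertions x) (permutations xs)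

S-list : ℕ → List (List ℕ) → List (List ℕ)
S-list n T = filter (λ π → All.all? (π avoids?_) T) (permutations [1‥ n ])

∣S∣ : ℕ → List (List ℕ) → ℕ
∣S∣ n T = length (S-list n T)

-- S-list-unique and ∈-S-list below show that S-list n T lists each element
-- of S n T exactly once, so that ∣S∣ n T is its cardinality.

∈-insertions⁺ : ∀ x as bs → as ++ [ x ] ++ bs ∈ insertions x (as ++ bs)
∈-insertions⁺ x []       []       = here refl
∈-insertions⁺ x []       (b ∷ bs) = here refl
∈-insertions⁺ x (a ∷ as) bs       = there (∈-map⁺ (a ∷_) (∈-insertions⁺ x as bs))

∈-insertions⇒↭ : ∀ x ys {zs} → zs ∈ insertions x ys → zs ↭ x ∷ ys
∈-insertions⇒↭ x []       (here refl) = ↭-refl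
∈-insertions⇒↭ x (y ∷ ys) (here refl) = ↭-refl
∈-insertions⇒↭ x (y ∷ ys) (there zs∈) with ∈-map⁻ (y ∷_) zs∈
... | ws , ws∈ , refl = ↭-trans (prep y (∈-insertions⇒↭ x ys ws∈)) (swap y x ↭-refl)

∈-permutations⁺ : ∀ xs {π} → π ↭ xs → π ∈ permutations xs
∈-permutations⁺ []       π↭ = here (↭-empty-inv π↭)
∈-permutations⁺ (x ∷ xs) π↭ with ∈-∃++ (∈-resp-↭ (↭-sym π↭) (here refl))
... | as , bs , refl = ∈-concatMap⁺ (insertions x)
  (lose (∈-permutations⁺ xs (drop-mid as [] π↭)) (∈-insertions⁺ x as bs))

∈-permutations⁻ : ∀ xs {π} → π ∈ permutations xs → π ↭ xs
∈-permutations⁻ []       (here refl) = ↭-refl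
∈-permutations⁻ (x ∷ xs) π∈ with find (∈-concatMap⁻ (insertions x) {permutations xs} π∈)
... | ys , ys∈ , π∈ys = ↭-trans (∈-insertions⇒↭ x ys π∈ys) (prep x (∈-permutations⁻ xs ys∈))

insertions-unique : ∀ x ys → x ∉ ys → Unique (insertions x ys)
insertions-unique x []       x∉ = [] ∷ []
insertions-unique x (y ∷ ys) x∉ =
  All.tabulate (λ w∈ eq → headDiffers (∈-map⁻ (y ∷_) w∈) eq)
  ∷ Unique.map⁺ ∷-injectiveʳ (insertions-unique x ys (x∉ ∘ there))
  where
  headDiffers : ∀ {w} → ∃[ v ] (v ∈ insertions x ys × w ≡ y ∷ v) → ¬ (x ∷ y ∷ ys ≡ w)
  headDiffers (v , _ , refl) refl = x∉ (here refl)

insertions-injective : ∀ x ys ys′ {zs} → x ∉ ys → x ∉ ys′ →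
  zs ∈ insertions x ys → zs ∈ insertions x ys′ → ys ≡ ys′
insertions-injective x [] [] _ _ _ _ = refl
insertions-injective x [] (y ∷ ys) _ x∉′ (here refl) (there q) with ∈-map⁻ (y ∷_) q
... | _ , _ , refl = contradiction (here refl) x∉′
insertions-injective x (y ∷ ys) [] x∉ _ (there p) (here refl) with ∈-map⁻ (y ∷_) p
... | _ , _ , refl = contradiction (here refl) x∉
insertions-injective x (y ∷ ys) (y′ ∷ ys′) _ _ (here refl) (here refl) = refl
insertions-injective x (y ∷ ys) (y′ ∷ ys′) _ x∉′ (here refl) (there q) with ∈-map⁻ (y′ ∷_) q
... | _ , _ , refl = contradiction (here refl) x∉′
insertions-injective x (y ∷ ys) (y′ ∷ ys′) x∉ _ (there p) (here refl) with ∈-map⁻ (y ∷_) p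
... | _ , _ , refl = contradiction (here refl) x∉
insertions-injective x (y ∷ ys) (y′ ∷ ys′) x∉ x∉′ (there p) (there q)
  with ∈-map⁻ (y ∷_) p | ∈-map⁻ (y′ ∷_) q
... | _ , p′ , refl | _ , q′ , refl =
  cong (y ∷_) (insertions-injective x ys ys′ (x∉ ∘ there) (x∉′ ∘ there) p′ q′)

concatMap-insertions-unique : ∀ x yss → (∀ {ys} → ys ∈ yss → x ∉ ys) → Unique yss →
  Unique (concatMap (insertions x) yss)
concatMap-insertions-unique x []         x∉ []        = []
concatMap-insertions-unique x (ys ∷ yss) x∉ (ys∉ ∷ u) =
  Unique.++⁺ (insertions-unique x ys (x∉ (here refl)))
             (concatMap-insertions-unique x yss (x∉ ∘ there) u) disjoint
  where
  disjoint : Disjoint (insertions x ys) (concatMap (insertions x) yss)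
  disjoint (p , q) with find (∈-concatMap⁻ (insertions x) {yss} q)
  ... | ys′ , ys′∈ , q′ = All.lookup ys∉ ys′∈
    (insertions-injective x ys ys′ (x∉ (here refl)) (x∉ (there ys′∈)) p q′)

permutations-unique : ∀ {xs} → Unique xs → Unique (permutations xs)
permutations-unique []                = [] ∷ []
permutations-unique {x ∷ xs} (x≢ ∷ u) = concatMap-insertions-unique x (permutations xs)
  (λ ys∈ x∈ys → All.lookup x≢ (∈-resp-↭ (∈-permutations⁻ xs ys∈) x∈ys) refl)
  (permutations-unique u)

S-list-unique : ∀ n T → Unique (S-list n T)
S-list-unique n T = Unique.filter⁺ (λ π → All.all? (π avoids?_) T)
  (permutations-unique (Unique.map⁺ suc-injective (Unique.upTo⁺ n)))

∈-S-list : ∀ n T π → (π ∈ S-list n T) ⇔ S n T π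
∈-S-list n T π = mk⇔
  (λ π∈ → let π∈perm , av = ∈-filter⁻ P? {xs = permutations [1‥ n ]} π∈
          in ∈-permutations⁻ [1‥ n ] π∈perm , av)
  (λ (π↭ , av) → ∈-filter⁺ P? (∈-permutations⁺ [1‥ n ] π↭) av)
  where P? = λ π → All.all? (π avoids?_) T

-- The n-th value is the coefficient of xⁿ.
PowerSeries : Set
PowerSeries = ℕ → ℤ

infix 4 _≈_
_≈_ : PowerSeries → PowerSeries → Set
P ≈ Q = ∀ n → P n ≡ Q n

infixl 7 _⊛_
_⊛_ : PowerSeries → PowerSeries → PowerSeries
(P ⊛ Q) n = Σℤ.sum {suc n} (λ k → P (toℕ k) ℤ.* Q (n ∸ toℕ k))

-- The coefficients are listed from the constant term upwards.
polynomial : List ℤ → PowerSeries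
polynomial []       n       = 0ℤ
polynomial (a ∷ as) zero    = a
polynomial (a ∷ as) (suc n) = polynomial as n

-- Division by a series with constant term 1 (long division); by /-correct and
-- /-unique, P / Q is the unique series whose product with Q is P.
infixl 7 _/_
_/_ : (P Q : PowerSeries) → {q₀ : True (Q 0 ℤ.≟ 1ℤ)} → PowerSeries
(P / Q) zero = P 0
(_/_ P Q {q₀}) (suc n) = _/_ (λ k → P (suc k) ℤ.- P 0 ℤ.* Q (suc k)) Q {q₀} n

private
  a+[b-a] : ∀ a b → a ℤ.+ (b ℤ.- a) ≡ b
  a+[b-a] = solve-∀

  [a+b]-a : ∀ a b → (a ℤ.+ b) ℤ.- a ≡ b
  [a+b]-a = solve-∀

/-correct : ∀ P Q {q₀ : True (Q 0 ℤ.≟ 1ℤ)} → (_/_ P Q {q₀}) ⊛ Q ≈ P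
/-correct P Q {q₀} zero = begin
  P 0 ℤ.* Q 0 ℤ.+ 0ℤ  ≡⟨ ℤ.+-identityʳ _ ⟩
  P 0 ℤ.* Q 0         ≡⟨ cong (P 0 ℤ.*_) (toWitness q₀) ⟩
  P 0 ℤ.* 1ℤ          ≡⟨ ℤ.*-identityʳ _ ⟩
  P 0                 ∎
  where open ≡-Reasoning
/-correct P Q {q₀} (suc n) = trans
  (cong (ℤ._+_ (P 0 ℤ.* Q (suc n))) (/-correct (λ k → P (suc k) ℤ.- P 0 ℤ.* Q (suc k)) Q {q₀} n))
  (a+[b-a] (P 0 ℤ.* Q (suc n)) (P (suc n)))

/-unique : ∀ F P Q {q₀ : True (Q 0 ℤ.≟ 1ℤ)} → F ⊛ Q ≈ P → F ≈ (_/_ P Q {q₀})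
/-unique F P Q {q₀} F⊛Q≈P = go
  where
  F₀≡P₀ : F 0 ≡ P 0
  F₀≡P₀ = begin
    F 0                 ≡⟨ ℤ.*-identityʳ _ ⟨
    F 0 ℤ.* 1ℤ          ≡⟨ cong (F 0 ℤ.*_) (toWitness q₀) ⟨
    F 0 ℤ.* Q 0         ≡⟨ ℤ.+-identityʳ _ ⟨
    F 0 ℤ.* Q 0 ℤ.+ 0ℤ  ≡⟨ F⊛Q≈P 0 ⟩
    P 0                 ∎
    where open ≡-Reasoning

  tail : (F ∘ suc) ⊛ Q ≈ (λ k → P (suc k) ℤ.- P 0 ℤ.* Q (suc k))
  tail n = trans (sym ([a+b]-a (F 0 ℤ.* Q (suc n)) _))
                 (cong₂ ℤ._-_ (F⊛Q≈P (suc n)) (cong (ℤ._* Q (suc n)) F₀≡P₀))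

  go : F ≈ (_/_ P Q {q₀})
  go zero    = F₀≡P₀
  go (suc n) = /-unique (F ∘ suc) _ Q {q₀} tail n

F : List (List ℕ) → PowerSeries
F T n = + ∣S∣ n T

{-# OPTIONS --safe #-}
module Submission where

-- Build a permutation from right to left: a new first value is inserted at one of
-- the n + 1 sites between the values 1, …, n.  Call a site middle if it is neither
-- the bottom nor the top one and inserting there creates no forbidden pattern; the
-- bottom and the top site never create one.  Only two kinds of permutation occur.
-- A linear one with m middle sites has as children a linear one with m + 1 (from the
-- bottom site), a forked one with 1 (from the top site) and m linear ones with 1.
-- A forked one with 1 + m middle sites has as children a linear one with 2 + m
-- (bottom), a forked one with 1 (top), a forked one with 2 + m (from its lowest
-- middle site) and m linear ones with 1.  Hence the number of descendants after a
-- fixed number of generations is affine in m, and its four coefficients satisfy a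
-- linear system of order 4, the one that long division by the denominator produces.

open import Defs
open import Data.Fin using (zero; suc; cast; #_)
open import Data.Integer using (+_; -_)
import Data.Integer as ℤ
import Data.Integer.Tactic.RingSolver as ℤ
open import Data.List using (List; []; _∷_; _++_; length; lookup; map; upTo; filter; concatMap)
open import Data.List.Membership.Propositional using (_∈_; _∉_; find; lose)
open import Data.List.Membership.Propositional.Properties
  using (∈-map⁺; ∈-map⁻; ∈-filter⁺; ∈-filter⁻; ∈-upTo⁺; ∈-upTo⁻; ∈-concatMap⁺; ∈-concatMap⁻)
open import Data.List.Membership.Propositional.Properties.WithK using (unique∧set⇒bag)
open import Data.List.Properties using (length-map; map-∘; map-++; map-injective; map-cong; ∷-injective)
open import Data.List.Relation.Binary.BagAndSetEquality using (∼bag⇒↭)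
open import Data.List.Relation.Binary.Disjoint.Propositional using (Disjoint)
open import Data.List.Relation.Binary.Permutation.Propositional using (_↭_; ↭-sym; ↭⇒↭ₛ)
open import Data.List.Relation.Binary.Permutation.Propositional.Properties
  using (∈-resp-↭; ↭-length) renaming (map⁺ to ↭-map⁺)
open import Data.List.Relation.Binary.Permutation.Setoid.Properties using (Unique-resp-↭)
open import Data.List.Relation.Binary.Sublist.Propositional using (_⊆_; []; _∷_; _∷ʳ_; from∈)
import Data.List.Relation.Binary.Sublist.Propositional as Sublist
open import Data.List.Relation.Unary.All using (All; []; _∷_)
import Data.List.Relation.Unary.All as All
import Data.List.Relation.Unary.All.Properties as All
open import Data.List.Relation.Unary.AllPairs using ([]; _∷_)
open import Data.List.Relation.Unary.Any using (Any; here; there; any?)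
import Data.List.Relation.Unary.Any as Any
import Data.List.Relation.Unary.Any.Properties as Any
open import Data.List.Relation.Unary.Unique.Propositional using (Unique)
import Data.List.Relation.Unary.Unique.Propositional.Properties as Unique
open import Data.Nat hiding (_/_)
open import Data.Nat.ListAction using (sum)
open import Data.Nat.ListAction.Properties using (sum-++; sum-↭)
open import Data.Nat.Properties
open import Data.Nat.Tactic.RingSolver using (solve-∀)
open import Data.Product using (∃-syntax; _×_; _,_; proj₁; proj₂)
open import Data.Sum using (_⊎_; inj₁; inj₂)
open import Data.Unit using (⊤; tt)
open import Function using (_∘_; _⇔_; mk⇔; Equivalence)
open import Relation.Binary.Definitions using (tri<; tri≈; tri>)
open import Relation.Binary.PropositionalEquality
open import Relation.Nullary using (¬_; Dec; yes; no; contradiction)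
open import Relation.Nullary.Decidable using (True; map′; ¬?; _×-dec_; _⊎-dec_)

-- Duplicate-free enumerations.

record Enumerates {A : Set} (P : A → Set) (xs : List A) : Set where
  field
    unique   : Unique xs
    sound    : ∀ {x} → x ∈ xs → P x
    complete : ∀ {x} → P x → x ∈ xs

open Enumerates

-- Neither list repeats an element and both have the same members. Lengths and sums over them
-- therefore agree, which lets sites be reordered.
enumerates-↭ : {A : Set} {P : A → Set} {xs ys : List A} →
  Enumerates P xs → Enumerates P ys → xs ↭ ys
enumerates-↭ p q = ∼bag⇒↭ (unique∧set⇒bag (unique p) (unique q)
  (mk⇔ (complete q ∘ sound p) (complete p ∘ sound q)))

concatMap-unique : {A B : Set} (f : A → List B) {xs : List A} →
  (∀ x → Unique (f x)) → (∀ {x y z} → z ∈ f x → z ∈ f y → x ≡ y) →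
  Unique xs → Unique (concatMap f xs)
concatMap-unique f f! sep [] = []
concatMap-unique f {x ∷ xs} f! sep (x∉ ∷ xs!) =
  Unique.++⁺ (f! x) (concatMap-unique f f! sep xs!) disjoint
  where
  disjoint : Disjoint (f x) (concatMap f xs)
  disjoint (p , q) with find (∈-concatMap⁻ f {xs = xs} q)
  ... | y , y∈ , q′ = All.lookup x∉ y∈ (sep p q′)

-- Sites at which an insertion creates a forbidden pattern.

-- These are the last two letters of a 3214. The bounds are separate because `x` serves both as the
-- second letter in `valley` and as a site whose insertion spoils a higher site `v`.
data Ascent (x v : ℕ) : List ℕ → Set where
  here  : ∀ {a π} → a ≤ x → Any (v <_) π → Ascent x v (a ∷ π)
  there : ∀ {a π} → Ascent x v π → Ascent x v (a ∷ π)

-- A site v of a list lies between the values ≤ v and the values > v.  Prepending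
-- a new value at the site v creates a forbidden pattern exactly when Bad v holds:
-- peak gives 2413 and 2431, valley gives 3214, the new value being the first letter.
data Bad (v : ℕ) : List ℕ → Set where
  peak   : ∀ {c π} → v < c → Any (_≤ v) π → Any (λ b → v < b × b < c) π → Bad v (c ∷ π)
  valley : ∀ {b π} → b ≤ v → Ascent b v π → Bad v (b ∷ π)
  there  : ∀ {x π} → Bad v π → Bad v (x ∷ π)

Good : ℕ → List ℕ → Set
Good v π = ¬ Bad v π

ascent? : ∀ x v π → Dec (Ascent x v π)
ascent? x v []      = no λ ()
ascent? x v (a ∷ π) = map′
  (λ { (inj₁ (p , q)) → here p q ; (inj₂ p) → there p })
  (λ { (here p q) → inj₁ (p , q) ; (there p) → inj₂ p })
  ((a ≤? x ×-dec any? (v <?_) π) ⊎-dec ascent? x v π)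

bad? : ∀ v π → Dec (Bad v π)
bad? v []      = no λ ()
bad? v (x ∷ π) = map′
  (λ { (inj₁ (p , q , r)) → peak p q r ; (inj₂ (inj₁ (p , q))) → valley p q
     ; (inj₂ (inj₂ p)) → there p })
  (λ { (peak p q r) → inj₁ (p , q , r) ; (valley p q) → inj₂ (inj₁ (p , q))
     ; (there p) → inj₂ (inj₂ p) })
  ((v <? x ×-dec any? (_≤? v) π ×-dec any? (λ b → v <? b ×-dec b <? x) π)
    ⊎-dec (x ≤? v ×-dec ascent? x v π) ⊎-dec bad? v π)

-- Invariance under increasing relabelling.

-- A relation between sites and not a map, since `bump v` relates the site `v` to both `v` and
-- `suc v`, on either side of the new value.
record Splits (f : ℕ → ℕ) (v v′ : ℕ) : Set where
  constructor splits
  field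
    below : ∀ {a} → a ≤ v → f a ≤ v′
    above : ∀ {a} → v < a → v′ < f a

  below⁻ : ∀ {a} → f a ≤ v′ → a ≤ v
  below⁻ fa≤v′ = ≮⇒≥ λ v<a → <⇒≱ (above v<a) fa≤v′

  above⁻ : ∀ {a} → v′ < f a → v < a
  above⁻ v′<fa = ≰⇒> λ a≤v → <⇒≱ v′<fa (below a≤v)

open Splits

-- Strict monotonicity, phrased so that a letter can itself act as a threshold.
Increasing : (ℕ → ℕ) → Set
Increasing f = ∀ v → Splits f v (f v)

ascent-map⁺ : ∀ {f x x′ v v′ π} → Splits f x x′ → Splits f v v′ →
  Ascent x v π → Ascent x′ v′ (map f π)
ascent-map⁺ sx sv (here p q) = here (below sx p) (Any.gmap (above sv) q)
ascent-map⁺ sx sv (there p)  = there (ascent-map⁺ sx sv p)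

ascent-map⁻ : ∀ {f x x′ v v′ π} → Splits f x x′ → Splits f v v′ →
  Ascent x′ v′ (map f π) → Ascent x v π
ascent-map⁻ {π = _ ∷ _} sx sv (here p q) = here (below⁻ sx p) (Any.map (above⁻ sv) (Any.map⁻ q))
ascent-map⁻ {π = _ ∷ _} sx sv (there p)  = there (ascent-map⁻ sx sv p)

bad-map⁺ : ∀ {f v v′ π} → Increasing f → Splits f v v′ → Bad v π → Bad v′ (map f π)
bad-map⁺ inc s (peak p q r) = peak (above s p) (Any.gmap (below s) q)
  (Any.gmap (λ (v<b , b<c) → above s v<b , above (inc _) b<c) r)
bad-map⁺ inc s (valley p q) = valley (below s p) (ascent-map⁺ (inc _) s q)
bad-map⁺ inc s (there p)    = there (bad-map⁺ inc s p)

bad-map⁻ : ∀ {f v v′ π} → Increasing f → Splits f v v′ → Bad v′ (map f π) → Bad v π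
bad-map⁻ {π = _ ∷ _} inc s (peak p q r) = peak (above⁻ s p) (Any.map (below⁻ s) (Any.map⁻ q))
  (Any.map (λ (v<b , b<c) → above⁻ s v<b , above⁻ (inc _) b<c) (Any.map⁻ r))
bad-map⁻ {π = _ ∷ _} inc s (valley p q) = valley (below⁻ s p) (ascent-map⁻ (inc _) s q)
bad-map⁻ {π = _ ∷ _} inc s (there p)    = there (bad-map⁻ inc s p)

-- Each letter is read as a site of the letters after it, and so is tested as the first letter of a
-- forbidden pattern.
Av : List ℕ → Set
Av []      = ⊤
Av (x ∷ π) = Good x π × Av π

av-map⁺ : ∀ {f π} → Increasing f → Av π → Av (map f π)
av-map⁺ {π = []}    inc av       = tt
av-map⁺ {π = x ∷ π} inc (g , av) = g ∘ bad-map⁻ inc (inc x) , av-map⁺ inc av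

av-map⁻ : ∀ {f π} → Increasing f → Av (map f π) → Av π
av-map⁻ {π = []}    inc av       = tt
av-map⁻ {π = x ∷ π} inc (g , av) = g ∘ bad-map⁺ inc (inc x) , av-map⁻ inc av

increasing⇒injective : ∀ {f} → Increasing f → ∀ {a b} → f a ≡ f b → a ≡ b
increasing⇒injective inc eq =
  ≤-antisym (below⁻ (inc _) (≤-reflexive eq)) (below⁻ (inc _) (≤-reflexive (sym eq)))

-- Insertion of a new first letter.

bump : ℕ → ℕ → ℕ
bump v w with w ≤? v
... | yes _ = w
... | no  _ = suc w

bump-≤ : ∀ {v w} → w ≤ v → bump v w ≡ w
bump-≤ {v} {w} w≤v with w ≤? v
... | yes _   = refl
... | no  w≰v = contradiction w≤v w≰v

bump-> : ∀ {v w} → v < w → bump v w ≡ suc w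
bump-> {v} {w} v<w with w ≤? v
... | yes w≤v = contradiction w≤v (<⇒≱ v<w)
... | no  _   = refl

bump-lower : ∀ {v w} → w ≤ v → Splits (bump v) w w
bump-lower {v} {w} w≤v = splits
  (λ a≤w → subst (_≤ w) (sym (bump-≤ (≤-trans a≤w w≤v))) a≤w)
  λ {a} w<a → up a w<a
  where
  up : ∀ a → w < a → w < bump v a
  up a w<a with a ≤? v
  ... | yes _ = w<a
  ... | no  _ = m≤n⇒m≤1+n w<a

bump-upper : ∀ {v w} → v ≤ w → Splits (bump v) w (suc w)
bump-upper {v} {w} v≤w = splits (λ {a} → down a)
  (λ w<a → subst (suc w <_) (sym (bump-> (≤-<-trans v≤w w<a))) (s≤s w<a))
  where
  down : ∀ a → a ≤ w → bump v a ≤ suc w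
  down a a≤w with a ≤? v
  ... | yes _ = m≤n⇒m≤1+n a≤w
  ... | no  _ = s≤s a≤w

bump-increasing : ∀ v → Increasing (bump v)
bump-increasing v w with w ≤? v
... | yes w≤v = bump-lower w≤v
... | no  w≰v = bump-upper (≰⇒≥ w≰v)

bump-injective : ∀ v {a b} → bump v a ≡ bump v b → a ≡ b
bump-injective v = increasing⇒injective (bump-increasing v)

bump-skips : ∀ v w → bump v w ≢ suc v
bump-skips v w with w ≤? v
... | yes w≤v = <⇒≢ (s≤s w≤v)
... | no  w≰v = λ { refl → w≰v ≤-refl }

ins : ℕ → List ℕ → List ℕ
ins v π = suc v ∷ map (bump v) π

ins-injective : ∀ {v v′ π π′} → ins v π ≡ ins v′ π′ → v ≡ v′ × π ≡ π′
ins-injective {v} eq with refl , eq′ ← ∷-injective eq = refl , map-injective (bump-injective v) eq′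

Perm : ℕ → List ℕ → Set
Perm n = Enumerates (λ w → 1 ≤ w × w ≤ n)

-- By `bump-upper`, the new letter `suc v`, as a site of the raised tail, corresponds to the site
-- `v` of `π`.
ins-av⁺ : ∀ {v π} → Good v π → Av π → Av (ins v π)
ins-av⁺ {v} good av =
  good ∘ bad-map⁻ (bump-increasing v) (bump-upper ≤-refl) , av-map⁺ (bump-increasing v) av

ins-av⁻ : ∀ {v π} → Av (ins v π) → Good v π × Av π
ins-av⁻ {v} (good , av) =
  good ∘ bad-map⁺ (bump-increasing v) (bump-upper ≤-refl) , av-map⁻ (bump-increasing v) av

∈-ins⁻ : ∀ {v w π} → w ∈ ins v π → w ≡ suc v ⊎ (∃[ a ] (a ∈ π × w ≡ bump v a))
∈-ins⁻ (here eq) = inj₁ eq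
∈-ins⁻ (there p) = inj₂ (∈-map⁻ _ p)

-- At `suc v`, the one value that `bump v` skips, the result is a mere default.
unbump : ℕ → ℕ → ℕ
unbump v w with w ≤? v
... | yes _ = w
... | no  _ = pred w

bump-unbump : ∀ {v w} → w ≢ suc v → bump v (unbump v w) ≡ w
bump-unbump {v} {w} w≢ with w ≤? v
... | yes w≤v = bump-≤ w≤v
bump-unbump {v} {zero}  w≢ | no w≰v = contradiction z≤n w≰v
bump-unbump {v} {suc w} w≢ | no w≰v = bump-> (≤∧≢⇒< (s≤s⁻¹ (≰⇒> w≰v)) (w≢ ∘ cong suc ∘ sym))

bump-bounds : ∀ {n v} w → v ≤ n → (1 ≤ w × w ≤ n) ⇔ (1 ≤ bump v w × bump v w ≤ suc n)
bump-bounds {n} {v} w v≤n with w ≤? v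
... | yes w≤v = mk⇔ (λ (p , q) → p , m≤n⇒m≤1+n q) (λ (p , q) → p , ≤-trans w≤v v≤n)
... | no  w≰v = mk⇔ (λ (p , q) → s≤s z≤n , s≤s q)
                    (λ (p , q) → ≤-trans (s≤s z≤n) (≰⇒> w≰v) , s≤s⁻¹ q)

ins-perm⁺ : ∀ {n v π} → v ≤ n → Perm n π → Perm (suc n) (ins v π)
ins-perm⁺ {n} {v} {π} v≤n perm = record
  { unique   = All.map⁺ (All.tabulate (λ {a} _ eq → bump-skips v a (sym eq)))
               ∷ Unique.map⁺ (bump-injective v) (unique perm)
  ; sound    = sound′
  ; complete = λ {w} → complete′ w
  }
  where
  sound′ : ∀ {w} → w ∈ ins v π → 1 ≤ w × w ≤ suc n
  sound′ w∈ with ∈-ins⁻ w∈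
  ... | inj₁ refl            = s≤s z≤n , s≤s v≤n
  ... | inj₂ (a , a∈ , refl) = Equivalence.to (bump-bounds a v≤n) (sound perm a∈)

  complete′ : ∀ w → 1 ≤ w × w ≤ suc n → w ∈ ins v π
  complete′ w bounds with w ≟ suc v
  ... | yes eq = here eq
  ... | no  w≢ = there (subst (_∈ map (bump v) π) (bump-unbump {v} {w} w≢) (∈-map⁺ (bump v)
    (complete perm (Equivalence.from (bump-bounds (unbump v w) v≤n)
      (subst (λ u → 1 ≤ u × u ≤ suc n) (sym (bump-unbump {v} {w} w≢)) bounds)))))

ins-perm⁻ : ∀ {n π} → Perm (suc n) π → ∃[ v ] ∃[ σ ] (v ≤ n × Perm n σ × π ≡ ins v σ)
ins-perm⁻ {π = []} perm = contradiction (complete perm (≤-refl , s≤s z≤n)) λ ()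
ins-perm⁻ {π = zero ∷ ρ} perm = contradiction (proj₁ (sound perm (here refl))) λ ()
ins-perm⁻ {n} {suc v ∷ ρ} perm with unique perm
... | x∉ρ ∷ ρ! = v , σ , v≤n , permσ , cong (suc v ∷_) (sym bump-σ)
  where
  v≤n = s≤s⁻¹ (proj₂ (sound perm (here refl)))
  σ   = map (unbump v) ρ

  rebump : ∀ {τ} → All (suc v ≢_) τ → map (bump v) (map (unbump v) τ) ≡ τ
  rebump []         = refl
  rebump (v≢ ∷ all) = cong₂ _∷_ (bump-unbump (v≢ ∘ sym)) (rebump all)

  bump-σ : map (bump v) σ ≡ ρ
  bump-σ = rebump x∉ρ

  in-σ : ∀ w → bump v w ∈ suc v ∷ ρ → w ∈ σ
  in-σ w (here eq) = contradiction eq (bump-skips v w)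
  in-σ w (there p) with ∈-map⁻ (bump v) (subst (bump v w ∈_) (sym bump-σ) p)
  ... | a , a∈ , eq = subst (_∈ σ) (sym (bump-injective v {w} {a} eq)) a∈

  permσ : Perm n σ
  permσ = record
    { unique   = Unique.map⁻ (subst Unique (sym bump-σ) ρ!)
    ; sound    = λ {w} w∈ → Equivalence.from (bump-bounds w v≤n)
        (sound perm (there (subst (bump v w ∈_) bump-σ (∈-map⁺ (bump v) w∈))))
    ; complete = λ {w} 1≤w≤n → in-σ w (complete perm (Equivalence.to (bump-bounds w v≤n) 1≤w≤n))
    }

-- `Av` as avoidance of the three patterns.

T : List (List ℕ)
T = (2 ∷ 4 ∷ 1 ∷ 3 ∷ []) ∷ (2 ∷ 4 ∷ 3 ∷ 1 ∷ []) ∷ (3 ∷ 2 ∷ 1 ∷ 4 ∷ []) ∷ []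

steps⇒increasing : ∀ {f} → (∀ a → f a < f (suc a)) → Increasing f
steps⇒increasing {f} step v = splits mono-≤ (mono-< _)
  where
  mono-< : ∀ {a} b → a < b → f a < f b
  mono-< {a} (suc b) a<1+b with m≤n⇒m<n∨m≡n (s≤s⁻¹ a<1+b)
  ... | inj₁ a<b  = <-trans (mono-< b a<b) (step b)
  ... | inj₂ refl = step b

  mono-≤ : ∀ {a} → a ≤ v → f a ≤ f v
  mono-≤ a≤v with m≤n⇒m<n∨m≡n a≤v
  ... | inj₁ a<v  = <⇒≤ (mono-< v a<v)
  ... | inj₂ refl = ≤-refl

lookup-cast : ∀ (f g : ℕ → ℕ) ρ (eq : length (map f ρ) ≡ length (map g ρ)) i →
  ∃[ a ] (lookup (map f ρ) i ≡ f a × lookup (map g ρ) (cast eq i) ≡ g a)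
lookup-cast f g (a ∷ ρ) eq zero    = a , refl , refl
lookup-cast f g (a ∷ ρ) eq (suc i) = lookup-cast f g ρ (suc-injective eq) i

increasing⇒orderIsomorphic : ∀ {f g} → Increasing f → Increasing g → ∀ ρ →
  OrderIsomorphic (map f ρ) (map g ρ)
increasing⇒orderIsomorphic {f} {g} incf incg ρ = eq , iso
  where
  eq = trans (length-map f ρ) (sym (length-map g ρ))
  iso : ∀ i j → (lookup (map f ρ) i < lookup (map f ρ) j)
              ⇔ (lookup (map g ρ) (cast eq i) < lookup (map g ρ) (cast eq j))
  iso i j with lookup-cast f g ρ eq i | lookup-cast f g ρ eq j
  ... | a , p , p′ | b , q , q′ rewrite p | p′ | q | q′ =
    mk⇔ (above (incg a) ∘ above⁻ (incf a)) (above (incf a) ∘ above⁻ (incg a))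

-- Continued past `z` to be strictly increasing everywhere, so that an occurrence and its pattern
-- are increasing images of one list `ρ` of ranks counted from 0.
extend : (w x y z : ℕ) → ℕ → ℕ
extend w x y z 0 = w
extend w x y z 1 = x
extend w x y z 2 = y
extend w x y z (suc (suc (suc n))) = n + z

pattern-occurs : ∀ {w x y z} ρ → w < x → x < y → y < z →
  OrderIsomorphic (map (extend w x y z) ρ) (map suc ρ)
pattern-occurs {w} {x} {y} {z} ρ w<x x<y y<z = increasing⇒orderIsomorphic
  (steps⇒increasing step) (steps⇒increasing λ _ → ≤-refl) ρ
  where
  step : ∀ a → extend w x y z a < extend w x y z (suc a)
  step 0 = w<x
  step 1 = x<y
  step 2 = y<z
  step (suc (suc (suc _))) = ≤-refl

quadruple : ∀ (σ : List ℕ) → length σ ≡ 4 → ∃[ w ] ∃[ x ] ∃[ y ] ∃[ z ] (σ ≡ w ∷ x ∷ y ∷ z ∷ [])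
quadruple (w ∷ x ∷ y ∷ z ∷ []) refl = w , x , y , z , refl

ascent-resp-⊆ : ∀ {x v σ π} → σ ⊆ π → Ascent x v σ → Ascent x v π
ascent-resp-⊆ (_ ∷ʳ s)   p          = there (ascent-resp-⊆ s p)
ascent-resp-⊆ (refl ∷ s) (here p q) = here p (Sublist.lookup s q)
ascent-resp-⊆ (refl ∷ s) (there p)  = there (ascent-resp-⊆ s p)

bad-resp-⊆ : ∀ {v σ π} → σ ⊆ π → Bad v σ → Bad v π
bad-resp-⊆ (_ ∷ʳ s)   p            = there (bad-resp-⊆ s p)
bad-resp-⊆ (refl ∷ s) (peak p q r) = peak p (Sublist.lookup s q) (Sublist.lookup s r)
bad-resp-⊆ (refl ∷ s) (valley p q) = valley p (ascent-resp-⊆ s q)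
bad-resp-⊆ (refl ∷ s) (there p)    = there (bad-resp-⊆ s p)

av-resp-⊆ : ∀ {σ π} → σ ⊆ π → Av π → Av σ
av-resp-⊆ []         av       = tt
av-resp-⊆ (_ ∷ʳ s)   (_ , av) = av-resp-⊆ s av
av-resp-⊆ (refl ∷ s) (g , av) = g ∘ bad-resp-⊆ s , av-resp-⊆ s av

-- `Av` passes to the four letters of an occurrence, whose first letter would be a bad site of the
-- other three.
av⇒avoids : ∀ {π} → Av π → All (π Avoids_) T
av⇒avoids {π} av = no-2413 ∷ no-2431 ∷ no-3214 ∷ []
  where
  no-2413 : π Avoids (2 ∷ 4 ∷ 1 ∷ 3 ∷ [])
  no-2413 (σ , s , eq , iso) with w , x , y , z , refl ← quadruple σ eq =
    proj₁ (av-resp-⊆ s av) (peak (lt (# 0) (# 1) (<ᵇ⇒< _ _ tt)) (here (<⇒≤ (lt (# 2) (# 0) (<ᵇ⇒< _ _ tt))))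
      (there (here (lt (# 0) (# 3) (<ᵇ⇒< _ _ tt) , lt (# 3) (# 1) (<ᵇ⇒< _ _ tt)))))
    where lt = λ i j → Equivalence.from (iso i j)

  no-2431 : π Avoids (2 ∷ 4 ∷ 3 ∷ 1 ∷ [])
  no-2431 (σ , s , eq , iso) with w , x , y , z , refl ← quadruple σ eq =
    proj₁ (av-resp-⊆ s av) (peak (lt (# 0) (# 1) (<ᵇ⇒< _ _ tt)) (there (here (<⇒≤ (lt (# 3) (# 0) (<ᵇ⇒< _ _ tt)))))
      (here (lt (# 0) (# 2) (<ᵇ⇒< _ _ tt) , lt (# 2) (# 1) (<ᵇ⇒< _ _ tt))))
    where lt = λ i j → Equivalence.from (iso i j)

  no-3214 : π Avoids (3 ∷ 2 ∷ 1 ∷ 4 ∷ [])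
  no-3214 (σ , s , eq , iso) with w , x , y , z , refl ← quadruple σ eq =
    proj₁ (av-resp-⊆ s av) (valley (<⇒≤ (lt (# 1) (# 0) (<ᵇ⇒< _ _ tt)))
      (here (<⇒≤ (lt (# 2) (# 1) (<ᵇ⇒< _ _ tt))) (here (lt (# 0) (# 3) (<ᵇ⇒< _ _ tt)))))
    where lt = λ i j → Equivalence.from (iso i j)

-- Separates 2413 from 2431, as `peak` leaves the order of its low and middle letters open.
pair-⊆ : ∀ {a b : ℕ} {π} → a ∈ π → b ∈ π → a ≢ b → (a ∷ b ∷ [] ⊆ π) ⊎ (b ∷ a ∷ [] ⊆ π)
pair-⊆ (here refl) (here refl) a≢b = contradiction refl a≢b
pair-⊆ (here refl) (there b∈)  a≢b = inj₁ (refl ∷ from∈ b∈)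
pair-⊆ (there a∈)  (here refl) a≢b = inj₂ (refl ∷ from∈ a∈)
pair-⊆ (there a∈)  (there b∈)  a≢b with pair-⊆ a∈ b∈ a≢b
... | inj₁ s = inj₁ (_ ∷ʳ s)
... | inj₂ s = inj₂ (_ ∷ʳ s)

ascent⇒⊆ : ∀ {x v π} → Ascent x v π → ∃[ a ] ∃[ d ] (a ≤ x × v < d × a ∷ d ∷ [] ⊆ π)
ascent⇒⊆ (here {a} p q) with find q
... | d , d∈ , v<d = a , d , p , v<d , refl ∷ from∈ d∈
ascent⇒⊆ (there p) with ascent⇒⊆ p
... | a , d , p , q , s = a , d , p , q , _ ∷ʳ s

-- Distinctness makes the weak inequalities in `Bad` strict. The list `ρ` stays fixed while the
-- recursion drops letters of `π`.
bad⇒contains : ∀ {v ρ π} → Unique π → v ∉ π → v ∷ π ⊆ ρ → Bad v π → ¬ All (ρ Avoids_) T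
bad⇒contains {v} {ρ} (c∉ ∷ _) v∉ s (peak {c} {π} v<c low mid) (no-2413 ∷ no-2431 ∷ _) with find low | find mid
... | a , a∈ , a≤v | b , b∈ , v<b , b<c with pair-⊆ a∈ b∈ (<⇒≢ (≤-<-trans a≤v v<b))
... | inj₁ ab = no-2413 (_ , Sublist.⊆-trans (refl ∷ refl ∷ ab) s ,
        pattern-occurs (1 ∷ 3 ∷ 0 ∷ 2 ∷ []) (≤∧≢⇒< a≤v λ { refl → v∉ (there a∈) }) v<b b<c)
... | inj₂ ba = no-2431 (_ , Sublist.⊆-trans (refl ∷ refl ∷ ba) s ,
        pattern-occurs (1 ∷ 3 ∷ 2 ∷ 0 ∷ []) (≤∧≢⇒< a≤v λ { refl → v∉ (there a∈) }) v<b b<c)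
bad⇒contains (b∉ ∷ _) v∉ s (valley b≤v asc) (_ ∷ _ ∷ no-3214 ∷ []) with ascent⇒⊆ asc
... | a , d , a≤b , v<d , ad = no-3214 (_ , Sublist.⊆-trans (refl ∷ refl ∷ ad) s ,
  pattern-occurs (2 ∷ 1 ∷ 0 ∷ 3 ∷ [])
    (≤∧≢⇒< a≤b (≢-sym (All.lookup b∉ (Sublist.lookup ad (here refl)))))
    (≤∧≢⇒< b≤v λ { refl → v∉ (here refl) }) v<d)
bad⇒contains (_ ∷ π!) v∉ s (there p) =
  bad⇒contains π! (v∉ ∘ there) (Sublist.⊆-trans (refl ∷ _ ∷ʳ Sublist.⊆-refl) s) p

avoids⇒av : ∀ {π} → Unique π → All (π Avoids_) T → Av π
avoids⇒av {[]}    π!         avoids = tt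
avoids⇒av {x ∷ π} (x∉ ∷ π!) avoids =
    (λ bad → bad⇒contains π! (λ x∈ → All.lookup x∉ x∈ refl) Sublist.⊆-refl bad avoids)
  , avoids⇒av π! (All.map (λ avoid (σ , s , iso) → avoid (σ , x ∷ʳ s , iso)) avoids)

-- `S-list` in terms of `Perm` and `Av`.

[1‥]-perm : ∀ n → Perm n [1‥ n ]
[1‥]-perm n = record
  { unique   = Unique.map⁺ suc-injective (Unique.upTo⁺ n)
  ; sound    = sound′
  ; complete = λ { {suc w} (_ , w<n) → ∈-map⁺ suc (∈-upTo⁺ w<n) }
  }
  where
  sound′ : ∀ {w} → w ∈ [1‥ n ] → 1 ≤ w × w ≤ n
  sound′ w∈ with w , w∈′ , refl ← ∈-map⁻ suc w∈ = s≤s z≤n , ∈-upTo⁻ w∈′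

↭⇒perm : ∀ {n π} → π ↭ [1‥ n ] → Perm n π
↭⇒perm {n} π↭ = record
  { unique   = Unique-resp-↭ (setoid ℕ) (↭⇒↭ₛ (↭-sym π↭)) (unique ([1‥]-perm n))
  ; sound    = sound ([1‥]-perm n) ∘ ∈-resp-↭ π↭
  ; complete = ∈-resp-↭ (↭-sym π↭) ∘ complete ([1‥]-perm n)
  }

S-list-enumerates : ∀ n → Enumerates (λ π → Perm n π × Av π) (S-list n T)
S-list-enumerates n = record
  { unique   = S-list-unique n T
  ; sound    = λ {π} π∈ → let π↭ , avoids = Equivalence.to (∈-S-list n T π) π∈
                              perm = ↭⇒perm π↭
                          in perm , avoids⇒av (unique perm) avoids
  ; complete = λ {π} (perm , av) → Equivalence.from (∈-S-list n T π)
      (enumerates-↭ perm ([1‥]-perm n) , av⇒avoids av)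
  }

-- The generating tree.

sites : ℕ → List ℕ → List ℕ
sites n π = filter (λ v → ¬? (bad? v π)) (upTo (suc n))

sites-enumerates : ∀ n π → Enumerates (λ v → v ≤ n × Good v π) (sites n π)
sites-enumerates n π = record
  { unique   = Unique.filter⁺ good? (Unique.upTo⁺ (suc n))
  ; sound    = λ v∈ → let v∈upTo , good = ∈-filter⁻ good? {xs = upTo (suc n)} v∈
                      in s≤s⁻¹ (∈-upTo⁻ v∈upTo) , good
  ; complete = λ (v≤n , good) → ∈-filter⁺ good? (∈-upTo⁺ (s≤s v≤n)) good
  }
  where good? = λ v → ¬? (bad? v π)

children : ℕ → List ℕ → List (List ℕ)
children n π = map (λ v → ins v π) (sites n π)

level : ℕ → List (List ℕ)
level zero    = [] ∷ []
level (suc n) = concatMap (children n) (level n)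

∈-children⁻ : ∀ {n π σ} → σ ∈ children n π → ∃[ v ] (v ≤ n × Good v π × σ ≡ ins v π)
∈-children⁻ {n} {π} σ∈ with v , v∈ , eq ← ∈-map⁻ (λ v → ins v π) σ∈ =
  let v≤n , good = sound (sites-enumerates n π) v∈ in v , v≤n , good , eq

-- `ins` is injective in site and permutation together, so no child arises twice. Removing the first
-- letter and closing the gap recovers the parent.
level-enumerates : ∀ n → Enumerates (λ π → Perm n π × Av π) (level n)
level-enumerates zero = record
  { unique   = [] ∷ []
  ; sound    = λ { (here refl) → record
      { unique = [] ; sound = λ () ; complete = λ (1≤w , w≤0) → contradiction (≤-trans 1≤w w≤0) λ () } , tt }
  ; complete = λ { {[]} _ → here refl
                 ; {x ∷ π} (perm , _) → let 1≤x , x≤0 = sound perm (here refl)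
                                        in contradiction (≤-trans 1≤x x≤0) λ () }
  }
level-enumerates (suc n) = record
  { unique   = concatMap-unique (children n)
      (λ π → Unique.map⁺ (proj₁ ∘ ins-injective) (unique (sites-enumerates n π)))
      same-parent (unique (level-enumerates n))
  ; sound    = sound′
  ; complete = complete′
  }
  where
  same-parent : ∀ {π π′ σ} → σ ∈ children n π → σ ∈ children n π′ → π ≡ π′
  same-parent p q with ∈-children⁻ p | ∈-children⁻ q
  ... | _ , _ , _ , eq | _ , _ , _ , eq′ = proj₂ (ins-injective (trans (sym eq) eq′))

  sound′ : ∀ {σ} → σ ∈ level (suc n) → Perm (suc n) σ × Av σ
  sound′ σ∈ with find (∈-concatMap⁻ (children n) {xs = level n} σ∈)
  ... | π , π∈ , σ∈π with ∈-children⁻ σ∈π | sound (level-enumerates n) π∈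
  ... | v , v≤n , good , refl | perm , av = ins-perm⁺ v≤n perm , ins-av⁺ good av

  complete′ : ∀ {σ} → Perm (suc n) σ × Av σ → σ ∈ level (suc n)
  complete′ (perm , av) with ins-perm⁻ perm
  ... | v , π , v≤n , permπ , refl with ins-av⁻ av
  ... | good , avπ = ∈-concatMap⁺ (children n) (lose
    (complete (level-enumerates n) (permπ , avπ))
    (∈-map⁺ (λ v → ins v π) (complete (sites-enumerates n π) (v≤n , good))))

descendants : ℕ → ℕ → List ℕ → ℕ
descendants zero    n π = 1
descendants (suc d) n π = sum (map (λ v → descendants d (suc n) (ins v π)) (sites n π))

sum-concatMap : {A B : Set} (f : B → ℕ) (g : A → List B) (xs : List A) →
  sum (map f (concatMap g xs)) ≡ sum (map (λ x → sum (map f (g x))) xs)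
sum-concatMap f g []       = refl
sum-concatMap f g (x ∷ xs) = begin
  sum (map f (g x ++ concatMap g xs))                  ≡⟨ cong sum (map-++ f (g x) _) ⟩
  sum (map f (g x) ++ map f (concatMap g xs))          ≡⟨ sum-++ (map f (g x)) _ ⟩
  sum (map f (g x)) + sum (map f (concatMap g xs))     ≡⟨ cong₂ _+_ refl (sum-concatMap f g xs) ⟩
  sum (map (λ x → sum (map f (g x))) (x ∷ xs))         ∎
  where open ≡-Reasoning

-- Induction on `d` with `n` varying: each step moves one generation from `d` to `n`.
length-level : ∀ n d → length (level (d + n)) ≡ sum (map (descendants d n) (level n))
length-level n zero    = sym (sum-ones (level n))
  where
  sum-ones : {A : Set} (xs : List A) → sum (map (λ _ → 1) xs) ≡ length xs
  sum-ones []       = refl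
  sum-ones (_ ∷ xs) = cong suc (sum-ones xs)
length-level n (suc d) = begin
  length (level (suc d + n))                             ≡⟨ cong (length ∘ level) (+-suc d n) ⟨
  length (level (d + suc n))                             ≡⟨ length-level (suc n) d ⟩
  sum (map (descendants d (suc n)) (level (suc n)))      ≡⟨ sum-concatMap _ (children n) (level n) ⟩
  sum (map (λ π → sum (map (descendants d (suc n)) (children n π))) (level n))
    ≡⟨ cong sum (map-cong (λ π → cong sum (sym (map-∘ (sites n π)))) (level n)) ⟩
  sum (map (descendants (suc d) n) (level n))            ∎
  where open ≡-Reasoning

-- Good sites of a permutation and of its children.

-- Peaks and valleys both need a letter at or below the site and a letter above it. The bottom site
-- lacks the former, the top site the latter.
good-bottom : ∀ {π} → All (1 ≤_) π → Good 0 π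
good-bottom (_ ∷ 1≤π) (peak _ low _) with a , a∈ , a≤0 ← find low =
  contradiction (≤-trans (All.lookup 1≤π a∈) a≤0) λ ()
good-bottom (1≤b ∷ _) (valley b≤0 _) = contradiction (≤-trans 1≤b b≤0) λ ()
good-bottom (_ ∷ 1≤π) (there bad)    = good-bottom 1≤π bad

ascent-bounds : ∀ {n x v π} → Perm n π → Ascent x v π → 1 ≤ x × v < n
ascent-bounds perm asc with a , d , a≤x , v<d , ad ← ascent⇒⊆ asc =
    ≤-trans (proj₁ (sound perm (Sublist.lookup ad (here refl)))) a≤x
  , <-≤-trans v<d (proj₂ (sound perm (Sublist.lookup ad (there (here refl)))))

good-top : ∀ {n π} → All (_≤ n) π → Good n π
good-top (c≤n ∷ _) (peak n<c _ _)   = <⇒≱ n<c c≤n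
good-top (_ ∷ π≤n) (valley _ asc) with a , d , _ , n<d , ad ← ascent⇒⊆ asc =
  <⇒≱ n<d (All.lookup π≤n (Sublist.lookup ad (there (here refl))))
good-top (_ ∷ π≤n) (there bad)      = good-top π≤n bad

Middle : ℕ → List ℕ → ℕ → Set
Middle n π v = 0 < v × v < n × Good v π

sites-↭ : ∀ {n π ms} → 0 < n → Perm n π → Enumerates (Middle n π) ms → sites n π ↭ 0 ∷ n ∷ ms
sites-↭ {n} {π} {ms} 0<n perm middles = enumerates-↭ (sites-enumerates n π) record
  -- Here `0 < n` keeps the bottom and the top site apart.
  { unique   = (<⇒≢ 0<n ∷ All.tabulate (<⇒≢ ∘ proj₁ ∘ sound middles))
             ∷ All.tabulate (≢-sym ∘ <⇒≢ ∘ proj₁ ∘ proj₂ ∘ sound middles)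
             ∷ unique middles
  ; sound    = λ
      { (here refl)         → z≤n , good-bottom (All.tabulate (proj₁ ∘ sound perm))
      ; (there (here refl)) → ≤-refl , good-top (All.tabulate (proj₂ ∘ sound perm))
      ; (there (there v∈))  → let _ , v<n , good = sound middles v∈ in <⇒≤ v<n , good
      }
  ; complete = λ {v} → complete′ v
  }
  where
  complete′ : ∀ v → v ≤ n × Good v π → v ∈ 0 ∷ n ∷ ms
  complete′ zero    _            = here refl
  complete′ (suc v) (v≤n , good) with m≤n⇒m<n∨m≡n v≤n
  ... | inj₁ v<n  = there (there (complete middles (s≤s z≤n , v<n , good)))
  ... | inj₂ refl = there (here refl)

-- The new letter `suc x` is the peak, with the values `1` at or below `w` and `x` strictly between.
bad-between : ∀ {n x w π} → Perm n π → x ≤ n → 0 < w → w < x → Bad w (ins x π)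
bad-between {x = x} perm x≤n 0<w w<x = peak (m<n⇒m<1+n w<x)
  (lose (∈-map⁺ (bump x) (complete perm (≤-refl , ≤-trans 1≤x x≤n)))
        (below (bump-lower (<⇒≤ w<x)) 0<w))
  (lose (∈-map⁺ (bump x) (complete perm (1≤x , x≤n)))
        (above (bump-lower (<⇒≤ w<x)) w<x , s≤s (≤-reflexive (bump-≤ {x} ≤-refl))))
  where 1≤x = ≤-trans 0<w (<⇒≤ w<x)

-- No value lies strictly between the site `x` and the new letter `suc x`, and that letter is too
-- large to start a valley.
good-below : ∀ {x π} → Good x π → Good x (ins x π)
good-below good (peak _ _ mid) with b , _ , x<b , b<1+x ← find mid = <⇒≱ x<b (s≤s⁻¹ b<1+x)
good-below good (valley 1+x≤x _) = 1+n≰n 1+x≤x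
good-below {x} good (there bad) = good (bad-map⁻ (bump-increasing x) (bump-lower ≤-refl) bad)

-- For a site above it, the new letter can only be the 2 of a 3214.
bad-above⁻ : ∀ {x w π} → x ≤ w → Bad (suc w) (ins x π) → Bad w π ⊎ Ascent x w π
bad-above⁻ x≤w (peak w<x _ _)   = contradiction (s≤s⁻¹ w<x) (≤⇒≯ x≤w)
bad-above⁻ x≤w (valley _ asc)   = inj₂ (ascent-map⁻ (bump-upper ≤-refl) (bump-upper x≤w) asc)
bad-above⁻ {x} x≤w (there bad)  = inj₁ (bad-map⁻ (bump-increasing x) (bump-upper x≤w) bad)

middle-ins⁻ : ∀ {n x u π} → Perm n π → x ≤ n → Middle (suc n) (ins x π) u →
  u ≡ x ⊎ (∃[ w ] (u ≡ suc w × x ≤ w × w < n × Good w π × ¬ Ascent x w π))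
middle-ins⁻ {x = x} {suc w} perm x≤n (0<u , u<1+n , good) with <-cmp (suc w) x
... | tri< u<x _ _ = contradiction (bad-between perm x≤n 0<u u<x) good
... | tri≈ _ u≡x _ = inj₁ u≡x
... | tri> _ _ x<u = inj₂ (w , refl , s≤s⁻¹ x<u , s≤s⁻¹ u<1+n
  , (λ bad → good (there (bad-map⁺ (bump-increasing x) (bump-upper (s≤s⁻¹ x<u)) bad)))
  , (λ asc → good (valley x<u (ascent-map⁺ (bump-upper ≤-refl) (bump-upper (s≤s⁻¹ x<u)) asc))))

middle-below : ∀ {n x π} → 0 < x → x ≤ n → Good x π → Middle (suc n) (ins x π) x
middle-below 0<x x≤n good = 0<x , s≤s x≤n , good-below good

middle-above : ∀ {n x w π} → x ≤ w → w < n → Good w π → ¬ Ascent x w π →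
  Middle (suc n) (ins x π) (suc w)
middle-above x≤w w<n good ¬asc = s≤s z≤n , s≤s w<n , above-good ∘ bad-above⁻ x≤w
  where
  above-good : ¬ (Bad _ _ ⊎ Ascent _ _ _)
  above-good (inj₁ bad) = good bad
  above-good (inj₂ asc) = ¬asc asc

-- The two kinds of permutation and their children.

-- An insertion at a middle site of a Linear permutation leaves no middle site
-- above the new value.
record Linear (n : ℕ) (π ms : List ℕ) : Set where
  field
    middles : Enumerates (Middle n π) ms
    ascents : ∀ {x v} → x ∈ ms → v ∈ ms → x ≤ v → Ascent x v π

-- In a Forked permutation the lowest middle site s is the exception: inserting
-- there keeps all the sites above s.
record Forked (n : ℕ) (π : List ℕ) (s : ℕ) (ms : List ℕ) : Set where
  field
    middles   : Enumerates (Middle n π) (s ∷ ms)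
    least     : All (s <_) ms
    no-ascent : ¬ Ascent s s π
    ascents   : ∀ {x v} → x ∈ ms → v ∈ ms → x ≤ v → Ascent x v π

ascent-lower : ∀ {x v w π} → v ≤ w → Ascent x w π → Ascent x v π
ascent-lower v≤w (here p q) = here p (Any.map (≤-<-trans v≤w) q)
ascent-lower v≤w (there p)  = there (ascent-lower v≤w p)

-- The new first letter `suc x` followed by the maximum `suc n` is the ascent.
ascent-from-head : ∀ {n x v u π} → Perm n π → x < n → suc x ≤ u → v ≤ n → Ascent u v (ins x π)
ascent-from-head {n} {x} perm x<n 1+x≤u v≤n = here 1+x≤u
  (lose (∈-map⁺ (bump x) (complete perm (≤-trans (s≤s z≤n) x<n , ≤-refl)))
        (subst (_ <_) (sym (bump-> x<n)) (s≤s v≤n)))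

-- No old letter is at or below 0, so no ascent spoils a site: each middle site moves up by one, and
-- the old bottom site becomes the middle site `1`.
ins-bottom : ∀ {n π ms} → 0 < n → Perm n π → Enumerates (Middle n π) ms →
  Linear (suc n) (ins 0 π) (1 ∷ map suc ms)
ins-bottom {n} {π} {ms} 0<n perm middles = record
  { middles = record
      { unique   = All.map⁺ (All.tabulate (<⇒≢ ∘ s≤s ∘ proj₁ ∘ sound middles))
                 ∷ Unique.map⁺ suc-injective (unique middles)
      ; sound    = sound′
      ; complete = complete′
      }
  ; ascents = λ x∈ v∈ _ → ascent-from-head perm 0<n (proj₁ (sound′ x∈))
                                           (s≤s⁻¹ (proj₁ (proj₂ (sound′ v∈))))
  }
  where
  no-ascent : ∀ {w} → ¬ Ascent 0 w π
  no-ascent asc = contradiction (proj₁ (ascent-bounds perm asc)) λ ()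

  sound′ : ∀ {u} → u ∈ 1 ∷ map suc ms → Middle (suc n) (ins 0 π) u
  sound′ (here refl) =
    middle-above z≤n 0<n (good-bottom (All.tabulate (proj₁ ∘ sound perm))) no-ascent
  sound′ (there u∈) with w , w∈ , refl ← ∈-map⁻ suc u∈ =
    let _ , w<n , good = sound middles w∈ in middle-above z≤n w<n good no-ascent

  complete′ : ∀ {u} → Middle (suc n) (ins 0 π) u → u ∈ 1 ∷ map suc ms
  complete′ mid with middle-ins⁻ perm z≤n mid
  ... | inj₁ refl = contradiction (proj₁ mid) λ ()
  ... | inj₂ (zero  , refl , _)                  = here refl
  ... | inj₂ (suc w , refl , _ , w<n , good , _) =
    there (∈-map⁺ suc (complete middles (s≤s z≤n , w<n , good)))

-- The new maximum spoils every middle site except `n`, just below it. The only letter above `n`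
-- comes first, so it ends no ascent.
ins-top : ∀ {n π} → 0 < n → Perm n π → Forked (suc n) (ins n π) n []
ins-top {n} {π} 0<n perm = record
  { middles = record
      { unique   = [] ∷ []
      ; sound    = λ { (here refl) →
          middle-below 0<n ≤-refl (good-top (All.tabulate (proj₂ ∘ sound perm))) }
      ; complete = complete′
      }
  ; least     = []
  ; no-ascent = no-ascent
  ; ascents   = λ ()
  }
  where
  complete′ : ∀ {u} → Middle (suc n) (ins n π) u → u ∈ n ∷ []
  complete′ mid with middle-ins⁻ perm ≤-refl mid
  ... | inj₁ refl                     = here refl
  ... | inj₂ (_ , _ , n≤w , w<n , _)  = contradiction w<n (≤⇒≯ n≤w)

  no-ascent : ¬ Ascent n n (ins n π)
  no-ascent (here 1+n≤n _) = 1+n≰n 1+n≤n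
  no-ascent (there asc)    = <-irrefl refl
    (proj₂ (ascent-bounds perm (ascent-map⁻ (bump-lower ≤-refl) (bump-lower ≤-refl) asc)))

-- Middle sites below `x` are lost to the new peak, and old sites from `x` upwards to ascents in
-- `π`. Only the site just below the new letter remains.
ins-pinch : ∀ {n x π} → Perm n π → Middle n π x →
  (∀ {w} → Middle n π w → x ≤ w → Ascent x w π) → Linear (suc n) (ins x π) (x ∷ [])
ins-pinch {n} {x} {π} perm mid@(0<x , x<n , good) asc = record
  { middles = record
      { unique   = [] ∷ []
      ; sound    = λ { (here refl) → middle-below 0<x (<⇒≤ x<n) good }
      ; complete = complete′
      }
  ; ascents = λ { (here refl) (here refl) _ →
      there (ascent-map⁺ (bump-lower ≤-refl) (bump-lower ≤-refl) (asc mid ≤-refl)) }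
  }
  where
  complete′ : ∀ {u} → Middle (suc n) (ins x π) u → u ∈ x ∷ []
  complete′ midu with middle-ins⁻ perm (<⇒≤ x<n) midu
  ... | inj₁ refl = here refl
  ... | inj₂ (w , refl , x≤w , w<n , goodw , ¬asc) =
    contradiction (asc (<-≤-trans 0<x x≤w , w<n , goodw) x≤w) ¬asc

linear-pinch : ∀ {n π x ms} → Perm n π → Linear n π ms → x ∈ ms →
  Linear (suc n) (ins x π) (x ∷ [])
linear-pinch perm lin x∈ =
  ins-pinch perm (sound middles x∈) λ mid x≤w → ascents x∈ (complete middles mid) x≤w
  where open Linear lin

forked-pinch : ∀ {n π s x ms} → Perm n π → Forked n π s ms → x ∈ ms →
  Linear (suc n) (ins x π) (x ∷ [])
forked-pinch {n} {π} {s} {x} {ms} perm fork x∈ =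
  ins-pinch perm (sound middles (there x∈)) (λ mid x≤w → above-x (complete middles mid) x≤w)
  where
  open Forked fork
  above-x : ∀ {w} → w ∈ s ∷ ms → x ≤ w → Ascent x w π
  above-x (here refl) x≤s = contradiction (All.lookup least x∈) (≤⇒≯ x≤s)
  above-x (there w∈)  x≤w = ascents x∈ w∈ x≤w

-- An ascent spoiling a site above `s` would also be an `Ascent s s`, so nothing is lost, and `s`
-- splits into `s` and `suc s`. The sites above `s` get their ascents from the new first letter and
-- the maximum.
forked-fork : ∀ {n π s ms} → Perm n π → Forked n π s ms →
  Forked (suc n) (ins s π) s (suc s ∷ map suc ms)
forked-fork {n} {π} {s} {ms} perm fork with Enumerates.sound (Forked.middles fork) (here refl)
... | 0<s , s<n , good = record
  { middles = record
      { unique   = All.map <⇒≢ least′ ∷ Unique.map⁺ suc-injective (unique middles)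
      ; sound    = sound′
      ; complete = complete′
      }
  ; least     = least′
  ; no-ascent = no-ascent′
  ; ascents   = λ x∈ v∈ _ → ascent-from-head perm s<n (All.lookup least′ x∈)
                              (s≤s⁻¹ (proj₁ (proj₂ (sound′ (there v∈)))))
  }
  where
  open Forked fork

  s≤ : All (s ≤_) (s ∷ ms)
  s≤ = ≤-refl ∷ All.map <⇒≤ least

  least′ : All (s <_) (map suc (s ∷ ms))
  least′ = All.map⁺ (All.map s≤s s≤)

  sound′ : ∀ {u} → u ∈ s ∷ map suc (s ∷ ms) → Middle (suc n) (ins s π) u
  sound′ (here refl) = middle-below 0<s (<⇒≤ s<n) good
  sound′ (there u∈) with w , w∈ , refl ← ∈-map⁻ suc u∈ =
    let _ , w<n , goodw = sound middles w∈
        s≤w = All.lookup s≤ w∈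
    in middle-above s≤w w<n goodw (no-ascent ∘ ascent-lower s≤w)

  complete′ : ∀ {u} → Middle (suc n) (ins s π) u → u ∈ s ∷ map suc (s ∷ ms)
  complete′ mid with middle-ins⁻ perm (<⇒≤ s<n) mid
  ... | inj₁ refl = here refl
  ... | inj₂ (w , refl , s≤w , w<n , goodw , _) =
    there (∈-map⁺ suc (complete middles (<-≤-trans 0<s s≤w , w<n , goodw)))

  no-ascent′ : ¬ Ascent s s (ins s π)
  no-ascent′ (here 1+s≤s _) = 1+n≰n 1+s≤s
  no-ascent′ (there asc)    = no-ascent (ascent-map⁻ (bump-lower ≤-refl) (bump-lower ≤-refl) asc)

-- Counting descendants.

-- A Linear permutation with m middle sites has p d + m q d descendants d
-- generations later, and a Forked one with 1 + m middle sites has r d + m s d.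
p q r s : ℕ → ℕ
p zero    = 1
p (suc d) = p d + q d + r d
q zero    = 0
q (suc d) = p d + q d + q d
r zero    = 1
r (suc d) = p d + q d + q d + r d + r d + s d
s zero    = 0
s (suc d) = p d + q d + q d + s d

sum-map-const : ∀ {f : ℕ → ℕ} {c} xs → (∀ {x} → x ∈ xs → f x ≡ c) → sum (map f xs) ≡ length xs * c
sum-map-const []       eq = refl
sum-map-const (x ∷ xs) eq = cong₂ _+_ (eq (here refl)) (sum-map-const xs (eq ∘ there))

descendants-↭ : ∀ d {n π xs} → sites n π ↭ xs →
  descendants (suc d) n π ≡ sum (map (λ v → descendants d (suc n) (ins v π)) xs)
descendants-↭ d = sum-↭ ∘ ↭-map⁺ _

linear-sum : ∀ p q r s m →
  p + suc m * q + (r + 0 * s + m * (p + 1 * q)) ≡ p + q + r + m * (p + q + q)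
linear-sum = solve-∀

forked-sum : ∀ p q r s m →
  p + suc (suc m) * q + (r + 0 * s + (r + suc m * s + m * (p + 1 * q)))
    ≡ p + q + q + r + r + s + m * (p + q + q + s)
forked-sum = solve-∀

-- Mutual induction on `d`, since each kind has children of both kinds.
descendants-linear : ∀ d {n π ms} → 0 < n → Perm n π → Linear n π ms →
  descendants d n π ≡ p d + length ms * q d
descendants-forked : ∀ d {n π t ms} → 0 < n → Perm n π → Forked n π t ms →
  descendants d n π ≡ r d + length ms * s d

descendants-linear zero {ms = ms} 0<n perm lin = sym (cong suc (*-zeroʳ (length ms)))
descendants-linear (suc d) {n} {π} {ms} 0<n perm lin = begin
  descendants (suc d) n π
    ≡⟨ descendants-↭ d {n} {π} (sites-↭ 0<n perm middles) ⟩
  f 0 + (f n + sum (map f ms))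
    ≡⟨ cong₂ _+_
         (descendants-linear d (s≤s z≤n) (ins-perm⁺ z≤n perm) (ins-bottom 0<n perm middles))
         (cong₂ _+_
           (descendants-forked d (s≤s z≤n) (ins-perm⁺ ≤-refl perm) (ins-top 0<n perm))
           (sum-map-const ms λ x∈ → descendants-linear d (s≤s z≤n)
             (ins-perm⁺ (<⇒≤ (proj₁ (proj₂ (sound middles x∈)))) perm) (linear-pinch perm lin x∈))) ⟩
  p d + suc (length (map suc ms)) * q d + (r d + 0 * s d + length ms * (p d + 1 * q d))
    ≡⟨ cong (λ m → p d + suc m * q d + (r d + 0 * s d + length ms * (p d + 1 * q d)))
            (length-map suc ms) ⟩
  p d + suc (length ms) * q d + (r d + 0 * s d + length ms * (p d + 1 * q d))
    ≡⟨ linear-sum (p d) (q d) (r d) (s d) (length ms) ⟩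
  p (suc d) + length ms * q (suc d) ∎
  where
  open ≡-Reasoning
  open Linear lin
  f = λ v → descendants d (suc n) (ins v π)

descendants-forked zero {ms = ms} 0<n perm fork = sym (cong suc (*-zeroʳ (length ms)))
descendants-forked (suc d) {n} {π} {t} {ms} 0<n perm fork = begin
  descendants (suc d) n π
    ≡⟨ descendants-↭ d {n} {π} (sites-↭ 0<n perm middles) ⟩
  f 0 + (f n + (f t + sum (map f ms)))
    ≡⟨ cong₂ _+_
         (descendants-linear d (s≤s z≤n) (ins-perm⁺ z≤n perm) (ins-bottom 0<n perm middles))
         (cong₂ _+_
           (descendants-forked d (s≤s z≤n) (ins-perm⁺ ≤-refl perm) (ins-top 0<n perm))
           (cong₂ _+_
             (descendants-forked d (s≤s z≤n) (ins-perm (here refl)) (forked-fork perm fork))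
             (sum-map-const ms λ x∈ → descendants-linear d (s≤s z≤n)
               (ins-perm (there x∈)) (forked-pinch perm fork x∈)))) ⟩
  count (length (map suc ms))
    ≡⟨ cong count (length-map suc ms) ⟩
  count (length ms)
    ≡⟨ forked-sum (p d) (q d) (r d) (s d) (length ms) ⟩
  r (suc d) + length ms * s (suc d) ∎
  where
  open ≡-Reasoning
  open Forked fork
  f = λ v → descendants d (suc n) (ins v π)
  ins-perm : ∀ {x} → x ∈ t ∷ ms → Perm (suc n) (ins x π)
  ins-perm x∈ = ins-perm⁺ (<⇒≤ (proj₁ (proj₂ (sound middles x∈)))) perm
  count = λ m → p d + suc (suc m) * q d
              + (r d + 0 * s d + (r d + suc m * s d + length ms * (p d + 1 * q d)))

singleton-perm : Perm 1 (1 ∷ [])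
singleton-perm = [1‥]-perm 1

singleton-linear : Linear 1 (1 ∷ []) []
singleton-linear = record
  { middles = record
      { unique   = []
      ; sound    = λ ()
      ; complete = λ (0<v , v<1 , _) → contradiction v<1 (≤⇒≯ 0<v)
      }
  ; ascents = λ ()
  }

-- The count starts from `1 ∷ []`, which is linear without middle sites. In the empty permutation
-- the bottom and the top site coincide.
∣S∣≡p : ∀ n → ∣S∣ (suc n) T ≡ p n
∣S∣≡p n = begin
  length (S-list (suc n) T)
    ≡⟨ ↭-length (enumerates-↭ (S-list-enumerates (suc n)) (level-enumerates (suc n))) ⟩
  length (level (suc n))
    ≡⟨ cong (length ∘ level) (+-comm 1 n) ⟩
  length (level (n + 1))
    ≡⟨ length-level 1 n ⟩
  descendants n 1 (1 ∷ []) + 0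
    ≡⟨ +-identityʳ _ ⟩
  descendants n 1 (1 ∷ [])
    ≡⟨ descendants-linear n ≤-refl singleton-perm singleton-linear ⟩
  p n + 0
    ≡⟨ +-identityʳ _ ⟩
  p n ∎
  where open ≡-Reasoning

-- Long division by the denominator.

denominator : PowerSeries
denominator = polynomial (+ 1 ∷ - + 6 ∷ + 11 ∷ - + 9 ∷ + 2 ∷ [])

quotient-cong : ∀ {P P′ Q} {q₀ : True (Q 0 ℤ.≟ ℤ.1ℤ)} → P ≈ P′ → (_/_ P Q {q₀}) ≈ (_/_ P′ Q {q₀})
quotient-cong P≈P′ zero    = P≈P′ 0
quotient-cong {Q = Q} {q₀} P≈P′ (suc n) = quotient-cong {Q = Q} {q₀}
  (λ k → cong₂ (λ x y → x ℤ.- y ℤ.* Q (suc k)) (P≈P′ (suc k)) (P≈P′ 0)) n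

-- The denominator has degree 4, so removing `a` times it and dropping the constant term again
-- leaves four coefficients.
long-division-step : ∀ a b c d n →
  (polynomial (a ∷ b ∷ c ∷ d ∷ []) / denominator) (suc n)
    ≡ (polynomial ( b ℤ.- a ℤ.* - + 6 ∷ c ℤ.- a ℤ.* + 11
                  ∷ d ℤ.- a ℤ.* - + 9 ∷ + 0 ℤ.- a ℤ.* + 2 ∷ []) / denominator) n
long-division-step a b c d = quotient-cong {Q = denominator} λ
  { 0 → refl ; 1 → refl ; 2 → refl ; 3 → refl ; (suc (suc (suc (suc _)))) → vanish a }
  where
  vanish : ∀ a → + 0 ℤ.- a ℤ.* + 0 ≡ + 0
  vanish = ℤ.solve-∀

-- If p, q, r, s take the values x, y, z, w at some index, this is the remainder
-- whose quotient lists p from that index on: the first coefficient is x, and the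
-- others are forced by the first steps of the division.
remainder : (x y z w : ℤ.ℤ) → List ℤ.ℤ
remainder x y z w =
    x
  ∷ y ℤ.+ z ℤ.- + 5 ℤ.* x
  ∷ + 8 ℤ.* x ℤ.- y ℤ.- + 3 ℤ.* z ℤ.+ w
  ∷ + 2 ℤ.* y ℤ.+ + 2 ℤ.* z ℤ.- + 4 ℤ.* x ℤ.- + 2 ℤ.* w
  ∷ []

remainder-step : ∀ n x y z w →
  (polynomial (remainder x y z w) / denominator) (suc n)
    ≡ (polynomial (remainder (x ℤ.+ y ℤ.+ z) (x ℤ.+ y ℤ.+ y)
         (x ℤ.+ y ℤ.+ y ℤ.+ z ℤ.+ z ℤ.+ w) (x ℤ.+ y ℤ.+ y ℤ.+ w)) / denominator) n
remainder-step n x y z w = trans (long-division-step x _ _ _ n)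
  (cong (λ as → (polynomial as / denominator) n)
    (cong₂ _∷_ (coefficient₀ x y z) (cong₂ _∷_ (coefficient₁ x y z w)
      (cong₂ _∷_ (coefficient₂ x y z w) (cong (_∷ []) (coefficient₃ x y z w))))))
  where
  coefficient₀ : ∀ x y z → y ℤ.+ z ℤ.- + 5 ℤ.* x ℤ.- x ℤ.* - + 6 ≡ x ℤ.+ y ℤ.+ z
  coefficient₀ = ℤ.solve-∀

  coefficient₁ : ∀ x y z w → + 8 ℤ.* x ℤ.- y ℤ.- + 3 ℤ.* z ℤ.+ w ℤ.- x ℤ.* + 11
    ≡ (x ℤ.+ y ℤ.+ y) ℤ.+ (x ℤ.+ y ℤ.+ y ℤ.+ z ℤ.+ z ℤ.+ w) ℤ.- + 5 ℤ.* (x ℤ.+ y ℤ.+ z)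
  coefficient₁ = ℤ.solve-∀

  coefficient₂ : ∀ x y z w →
    + 2 ℤ.* y ℤ.+ + 2 ℤ.* z ℤ.- + 4 ℤ.* x ℤ.- + 2 ℤ.* w ℤ.- x ℤ.* - + 9
    ≡ + 8 ℤ.* (x ℤ.+ y ℤ.+ z) ℤ.- (x ℤ.+ y ℤ.+ y)
      ℤ.- + 3 ℤ.* (x ℤ.+ y ℤ.+ y ℤ.+ z ℤ.+ z ℤ.+ w) ℤ.+ (x ℤ.+ y ℤ.+ y ℤ.+ w)
  coefficient₂ = ℤ.solve-∀

  coefficient₃ : ∀ x y z w → + 0 ℤ.- x ℤ.* + 2
    ≡ + 2 ℤ.* (x ℤ.+ y ℤ.+ y) ℤ.+ + 2 ℤ.* (x ℤ.+ y ℤ.+ y ℤ.+ z ℤ.+ z ℤ.+ w)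
      ℤ.- + 4 ℤ.* (x ℤ.+ y ℤ.+ z) ℤ.- + 2 ℤ.* (x ℤ.+ y ℤ.+ y ℤ.+ w)
  coefficient₃ = ℤ.solve-∀

remainder-quotient : ∀ k n →
  (polynomial (remainder (+ p n) (+ q n) (+ r n) (+ s n)) / denominator) k ≡ + p (k + n)
remainder-quotient zero    n = refl
remainder-quotient (suc k) n = begin
  (polynomial (remainder (+ p n) (+ q n) (+ r n) (+ s n)) / denominator) (suc k)
    ≡⟨ remainder-step k (+ p n) (+ q n) (+ r n) (+ s n) ⟩
  -- The arguments produced by `remainder-step` are the recursion of `p`, `q`, `r`, `s`, because
  -- `ℤ._+_` computes on nonnegative arguments.
  (polynomial (remainder (+ p (suc n)) (+ q (suc n)) (+ r (suc n)) (+ s (suc n))) / denominator) k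
    ≡⟨ remainder-quotient k (suc n) ⟩
  + p (k + suc n)
    ≡⟨ cong (λ m → + p m) (+-suc k n) ⟩
  + p (suc k + n) ∎
  where open ≡-Reasoning

theorem27 : F ((2 ∷ 4 ∷ 1 ∷ 3 ∷ []) ∷ (2 ∷ 4 ∷ 3 ∷ 1 ∷ []) ∷ (3 ∷ 2 ∷ 1 ∷ 4 ∷ []) ∷ [])
    ≈ polynomial (+ 1 ∷ - + 5 ∷ + 7 ∷ - + 4 ∷ [])
    / polynomial (+ 1 ∷ - + 6 ∷ + 11 ∷ - + 9 ∷ + 2 ∷ [])
theorem27 zero    = refl
theorem27 (suc n) = begin
  + ∣S∣ (suc n) T
    ≡⟨ cong +_ (∣S∣≡p n) ⟩
  + p n
    ≡⟨ cong (λ m → + p m) (+-identityʳ n) ⟨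
  + p (n + 0)
    ≡⟨ remainder-quotient n 0 ⟨
  -- The initial values of `p`, `q`, `r`, `s` give the coefficients 1, -4, 5, -2, which are also
  -- what the first division step leaves of the numerator.
  (polynomial (remainder (+ 1) (+ 0) (+ 1) (+ 0)) / denominator) n
    ≡⟨ long-division-step (+ 1) (- + 5) (+ 7) (- + 4) n ⟨
  (polynomial (+ 1 ∷ - + 5 ∷ + 7 ∷ - + 4 ∷ []) / denominator) (suc n) ∎
  where open ≡-Reasoning
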